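{- Let $\rho: 2^{A^*} \to R$ be a multiplicative rating map. Then the $\mathcal{B}\Sigma_1$-optimal universal $\rho$-imprint $\mathcal{I}_{\mathcal{B}\Sigma_1}[\rho] \subseteq R$ is the least (for inclusion) $\mathcal{B}\Sigma_1$-saturated subset of $R$ for $\rho$.
   Context: $A$ is a fixed finite alphabet; languages are subsets of $A^*$ and a class of languages is a set of languages over $A$. For $w \in A^*$, $\mathrm{alph}(w)$ is the set of letters occurring in $w$; for $B \subseteq A$, $B^{\circledast} = \{w \in A^* \mid \mathrm{alph}(w) = B\}$. **The class $\mathcal{B}\Sigma_1$.** A word is viewed as a (possibly empty) linearly ordered sequence of positions labeled over $A$; first-order sentences use unary predicates $P_a$ ($a\in A$, "the position carries $a$") and the strict order $<$. A $\Sigma_1$ sentence is one whose prenex normal form has only existential quantifiers (a single block of existential quantifiers, or no quantifier), and a $\mathcal{B}\Sigma_1$ sentence is a Boolean combination of $\Sigma_1$ sentences. $\mathcal{B}\Sigma_1$ also denotes the class of languages over $A$ definable by such sentences. **Multiplicative rating maps.** Semirings have a commutative additive monoid $(R,+,0_R)$, a multiplicative monoid $(R,\cdot,1_R)$, multiplication distributes over addition, and $0_R$ is a zero for multiplication. A semiring is idempotent if $r+r=r$ for all $r$. It is ordered by $r\leq s$ iff $r+s=s$. A multiplicative rating map is a semiring morphism $\rho:(2^{A^*},\cup,\cdot)\to(R,+,\cdot)$ where $R$ is a finite idempotent semiring: $\rho(\emptyset)=0_R$, $\rho(K_1\cup K_2)=\rho(K_1)+\rho(K_2)$, $\rho(\{\varepsilon\})=1_R$,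 $\rho(K_1K_2)=\rho(K_1)\rho(K_2)$. Write $\rho(w)$ for $\rho(\{w\})$. **Imprints.** For a finite set $\mathbf{K}$ of languages, $\mathcal{I}[\rho](\mathbf{K})=\{r\in R\mid \exists K\in\mathbf{K},\ r\leq\rho(K)\}$. A universal $\mathcal{C}$-cover is a finite set $\mathbf{K}$ of languages of $\mathcal{C}$ whose union is $A^*$. It is optimal for $\rho$ if $\mathcal{I}[\rho](\mathbf{K})\subseteq\mathcal{I}[\rho](\mathbf{K}')$ for every universal $\mathcal{C}$-cover $\mathbf{K}'$ (one always exists when $\mathcal{C}$ contains $\emptyset, A^*$ and is closed under union and intersection). $\mathcal{I}_{\mathcal{C}}[\rho]$ is $\mathcal{I}[\rho](\mathbf{K})$ for any optimal universal $\mathcal{C}$-cover $\mathbf{K}$ for $\rho$. **Saturation.** Let $\mathcal{I}_{triv}[\rho]=\{r\in R\mid \exists w\in A^*,\ r\leq\rho(w)\}$, and for $s\in R$ let $s^\omega$ denote the multiplicative idempotent power of $s$. A set $S\subseteq R$ is $\mathcal{B}\Sigma_1$-saturated for $\rho$ if it contains $\mathcal{I}_{triv}[\rho]$ and: (1) if $r\in S$ and $r'\leq r$ then $r'\in S$; (2) if $s,t\in S$ then $st\in S$; (3) for all $B\subseteq A$, $(\rho(B^{\circledast}))^\omega\in S$. -}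

module Defs where

open import Level using (Level; 0ℓ; _⊔_) renaming (suc to lsuc)
open import Algebra.Bundles using (IdempotentSemiring)
open import Algebra.Bundles.Raw using (RawSemiring)
open import Algebra.Morphism.Structures using (IsSemiringHomomorphism)
open import Data.Fin.Base using (Fin; toℕ) renaming (_<_ to _<ᶠ_)
open import Data.Fin.Properties using (pigeonhole)
open import Data.List.Base using (List; []; _++_; length; lookup)
open import Data.List.Membership.Propositional using () renaming (_∈_ to _∈ˡ_)
open import Data.List.Relation.Unary.All using (All)
open import Data.List.Relation.Unary.Any using (Any)
open import Data.Nat.Base using (ℕ; zero; suc; _+_; _*_; _∸_)
import Data.Nat.Properties as ℕ
open import Data.Product.Base using (∃; ∃₂; _×_; _,_; proj₁; proj₂)
open import Data.Sum.Base using (_⊎_)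
open import Data.Unit.Base using (⊤)
open import Data.Vec.Functional using (Vector) renaming ([] to []ᵛ; _∷_ to _∷ᵛ_)
open import Function.Bundles using (Inverse)
open import Relation.Binary.Bundles using (Setoid)
open import Relation.Binary.PropositionalEquality as ≡ using (_≡_)
open import Relation.Nullary.Negation.Core using (¬_)
open import Relation.Unary using (Pred; _∈_; _⊆_; _≐_; _∪_; ∅; ｛_｝)

private
  variable
    c ℓ s : Level
    A : Set

IsFinite : Setoid c ℓ → Set (c ⊔ ℓ)
IsFinite X = ∃ λ n → Inverse X (≡.setoid (Fin n))

Language : Set → Set₁
Language A = Pred (List A) 0ℓ

LanguageClass : Set → Set₁
LanguageClass A = Pred (Language A) 0ℓ

infixl 7 _·_
_·_ : Language A → Language A → Language A
(K · L) w = ∃₂ λ u v → w ≡ u ++ v × u ∈ K × v ∈ L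

languageRawSemiring : Set → RawSemiring (lsuc 0ℓ) 0ℓ
languageRawSemiring A = record
  { Carrier = Language A
  ; _≈_     = _≐_
  ; _+_     = _∪_
  ; _*_     = _·_
  ; 0#      = ∅
  ; 1#      = ｛ [] ｝
  }

alph : List A → Pred A 0ℓ
alph w a = a ∈ˡ w

_⊛ : Pred A 0ℓ → Language A
(B ⊛) w = alph w ≐ B

------------------------------------------------------------------------
-- First-order logic on words

-- Formulas whose free variables are among n variables (de Bruijn indices).
-- The constant `true` is needed because, without it, there would be no
-- quantifier-free sentence: the signature has no constant symbols.
data Formula (A : Set) (n : ℕ) : Set where
  true      : Formula A n
  P         : A → Fin n → Formula A n
  _≺_       : Fin n → Fin n → Formula A n
  not       : Formula A n → Formula A n
  _and_     : Formula A n → Formula A n → Formula A n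
  _or_      : Formula A n → Formula A n → Formula A n
  exists    : Formula A (suc n) → Formula A n
  forall′   : Formula A (suc n) → Formula A n

Sat : ∀ {n} (w : List A) → Vector (Fin (length w)) n → Formula A n → Set
Sat w ν true        = ⊤
Sat w ν (P a x)     = lookup w (ν x) ≡ a
Sat w ν (x ≺ y)     = ν x <ᶠ ν y
Sat w ν (not φ)     = ¬ Sat w ν φ
Sat w ν (φ and ψ)   = Sat w ν φ × Sat w ν ψ
Sat w ν (φ or ψ)    = Sat w ν φ ⊎ Sat w ν ψ
Sat w ν (exists φ)  = ∃ λ i → Sat w (i ∷ᵛ ν) φ
Sat w ν (forall′ φ) = ∀ i → Sat w (i ∷ᵛ ν) φ

Sentence : Set → Set
Sentence A = Formula A 0

⟦_⟧ : Sentence A → Language A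
⟦ φ ⟧ w = Sat w []ᵛ φ

data IsQuantifierFree {A : Set} {n : ℕ} : Formula A n → Set where
  true  : IsQuantifierFree true
  P     : ∀ a x → IsQuantifierFree (P a x)
  _≺_   : ∀ x y → IsQuantifierFree (x ≺ y)
  not   : ∀ {φ} → IsQuantifierFree φ → IsQuantifierFree (not φ)
  _and_ : ∀ {φ ψ} → IsQuantifierFree φ → IsQuantifierFree ψ →
          IsQuantifierFree (φ and ψ)
  _or_  : ∀ {φ ψ} → IsQuantifierFree φ → IsQuantifierFree ψ →
          IsQuantifierFree (φ or ψ)

-- Σ₁ formulas are taken in prenex normal form.
data IsΣ₁ {A : Set} : ∀ {n} → Formula A n → Set where
  matrix : ∀ {n} {φ : Formula A n} → IsQuantifierFree φ → IsΣ₁ φ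
  exists : ∀ {n} {φ : Formula A (suc n)} → IsΣ₁ φ → IsΣ₁ (exists φ)

data IsBΣ₁ {A : Set} : Sentence A → Set where
  base  : ∀ {φ} → IsΣ₁ φ → IsBΣ₁ φ
  not   : ∀ {φ} → IsBΣ₁ φ → IsBΣ₁ (not φ)
  _and_ : ∀ {φ ψ} → IsBΣ₁ φ → IsBΣ₁ ψ → IsBΣ₁ (φ and ψ)
  _or_  : ∀ {φ ψ} → IsBΣ₁ φ → IsBΣ₁ ψ → IsBΣ₁ (φ or ψ)

BΣ₁ : LanguageClass A
BΣ₁ {A} L = ∃ λ (φ : Sentence A) → IsBΣ₁ φ × L ≐ ⟦ φ ⟧

------------------------------------------------------------------------
-- Finite idempotent semirings

record FiniteIdempotentSemiring c ℓ : Set (lsuc (c ⊔ ℓ)) where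
  field
    idempotentSemiring : IdempotentSemiring c ℓ

  open IdempotentSemiring idempotentSemiring public
    renaming (_+_ to _⊕_; _*_ to _⊗_)

  field
    finite : IsFinite setoid

  infix 4 _≤_
  _≤_ : Carrier → Carrier → Set ℓ
  r ≤ s = r ⊕ s ≈ s

  open import Algebra.Properties.Semiring.Exp semiring public
    using (_^_; ^-congʳ; ^-congˡ; ^-homo-*; ^-assocʳ)

  open import Relation.Binary.Reasoning.Setoid setoid

  IsIdempotentPower : Carrier → Carrier → Set ℓ
  IsIdempotentPower s e = (∃ λ n → e ≈ s ^ suc n) × e ⊗ e ≈ e

  private
    idem-^ : ∀ {e} → e ⊗ e ≈ e → ∀ n → e ^ suc n ≈ e
    idem-^ ee≈e zero = *-identityʳ _
    idem-^ ee≈e (suc n) = trans (*-congˡ (idem-^ ee≈e n)) ee≈e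

  IsIdempotentPower-unique : ∀ {s e f} → IsIdempotentPower s e →
                             IsIdempotentPower s f → e ≈ f
  IsIdempotentPower-unique {s} {e} {f} ((m , e≈) , ee) ((n , f≈) , ff) = begin
    e                      ≈⟨ idem-^ ee n ⟨
    e ^ suc n              ≈⟨ ^-congˡ (suc n) e≈ ⟩
    (s ^ suc m) ^ suc n    ≈⟨ ^-assocʳ s (suc m) (suc n) ⟩
    s ^ (suc m * suc n)    ≈⟨ ^-congʳ s (ℕ.*-comm (suc m) (suc n)) ⟩
    s ^ (suc n * suc m)    ≈⟨ ^-assocʳ s (suc n) (suc m) ⟨
    (s ^ suc n) ^ suc m    ≈⟨ ^-congˡ (suc m) f≈ ⟨
    f ^ suc m              ≈⟨ idem-^ ff m ⟩
    f                      ∎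

  private
    repetition : ∀ s → ∃₂ λ i p → s ^ suc i ≈ s ^ (suc i + suc p)
    repetition s with pigeonhole (ℕ.n<1+n (proj₁ finite))
                                 (λ i → Inverse.to (proj₂ finite) (s ^ suc (toℕ i)))
    ... | i , j , i<j , eq = toℕ i , toℕ j ∸ suc (toℕ i) ,
          trans (trans (sym (Inverse.inverseʳ (proj₂ finite) ≡.refl))
                       (Inverse.inverseʳ (proj₂ finite) eq))
                (^-congʳ s (≡.cong suc (≡.sym
                  (≡.trans (ℕ.+-suc (toℕ i) _) (ℕ.m+[n∸m]≡n i<j)))))

    module _ (s : Carrier) (a p : ℕ) (rep : s ^ a ≈ s ^ (a + p)) where

      shift : ∀ d → s ^ (a + d) ≈ s ^ (a + d + p)
      shift d = begin
        s ^ (a + d)        ≈⟨ ^-homo-* s a d ⟩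
        s ^ a ⊗ s ^ d      ≈⟨ *-congʳ rep ⟩
        s ^ (a + p) ⊗ s ^ d ≈⟨ ^-homo-* s (a + p) d ⟨
        s ^ (a + p + d)    ≈⟨ ^-congʳ s (≡.trans (ℕ.+-assoc a p d)
                                (≡.trans (≡.cong (a +_) (ℕ.+-comm p d))
                                         (≡.sym (ℕ.+-assoc a d p)))) ⟩
        s ^ (a + d + p)    ∎

      shifts : ∀ k d → s ^ (a + d) ≈ s ^ (a + d + k * p)
      shifts zero d = ^-congʳ s (≡.sym (ℕ.+-identityʳ (a + d)))
      shifts (suc k) d = begin
        s ^ (a + d)               ≈⟨ shift d ⟩
        s ^ (a + d + p)           ≈⟨ ^-congʳ s (ℕ.+-assoc a d p) ⟩
        s ^ (a + (d + p))         ≈⟨ shifts k (d + p) ⟩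
        s ^ (a + (d + p) + k * p) ≈⟨ ^-congʳ s (≡.trans
              (≡.cong (_+ k * p) (≡.sym (ℕ.+-assoc a d p)))
              (ℕ.+-assoc (a + d) p (k * p))) ⟩
        s ^ (a + d + suc k * p)   ∎

  idempotentPower : ∀ s → ∃ (IsIdempotentPower s)
  idempotentPower s with repetition s
  ... | i , p , rep = s ^ (suc i * suc p) , (p + i * suc p , refl) , (begin
      s ^ m ⊗ s ^ m          ≈⟨ ^-homo-* s m m ⟨
      s ^ (m + m)            ≈⟨ ^-congʳ s (≡.cong (_+ m) m≡) ⟨
      s ^ (suc i + d + m)    ≈⟨ shifts s (suc i) (suc p) rep (suc i) d ⟨
      s ^ (suc i + d)        ≈⟨ ^-congʳ s m≡ ⟩
      s ^ m                  ∎)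
    where
      m d : ℕ
      m = suc i * suc p
      d = m ∸ suc i
      m≡ : suc i + d ≡ m
      m≡ = ℕ.m+[n∸m]≡n (ℕ.m≤m*n (suc i) (suc p))

  -- Well defined by IsIdempotentPower-unique.
  infix 9 _^ω
  _^ω : Carrier → Carrier
  s ^ω = proj₁ (idempotentPower s)

------------------------------------------------------------------------
-- Rating maps, imprints, covers

record MultiplicativeRatingMap (A : Set) (R : FiniteIdempotentSemiring c ℓ)
       : Set (lsuc 0ℓ ⊔ c ⊔ ℓ) where
  open FiniteIdempotentSemiring R using (Carrier; rawSemiring)
  field
    ρ                      : Language A → Carrier
    isSemiringHomomorphism :
      IsSemiringHomomorphism (languageRawSemiring A) rawSemiring ρ

  open IsSemiringHomomorphism isSemiringHomomorphism public

-- A finite set of languages is represented by a list.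
module _ {A : Set} where

  IsUniversalCover : LanguageClass A → Pred (List (Language A)) (lsuc 0ℓ)
  IsUniversalCover C Ks = All C Ks × (∀ w → Any (w ∈_) Ks)

module _ {A : Set} {R : FiniteIdempotentSemiring c ℓ}
         (rm : MultiplicativeRatingMap A R) where
  open FiniteIdempotentSemiring R
  open MultiplicativeRatingMap rm using (ρ)

  I[_] : List (Language A) → Pred Carrier (lsuc 0ℓ ⊔ ℓ)
  I[ Ks ] r = Any (λ K → r ≤ ρ K) Ks

  IsOptimalUniversalCover : LanguageClass A →
                            Pred (List (Language A)) (lsuc 0ℓ ⊔ c ⊔ ℓ)
  IsOptimalUniversalCover C Ks =
    IsUniversalCover C Ks ×
    (∀ Ks′ → IsUniversalCover C Ks′ → I[ Ks ] ⊆ I[ Ks′ ])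

  -- The imprint shared by all optimal universal C-covers (it is empty when
  -- there is none); see optimalImprint-unique.
  OptimalImprint : LanguageClass A → Pred Carrier (lsuc 0ℓ ⊔ c ⊔ ℓ)
  OptimalImprint C r = ∃ λ Ks → IsOptimalUniversalCover C Ks × r ∈ I[ Ks ]

  optimalImprint-unique : ∀ C Ks → IsOptimalUniversalCover C Ks →
                          OptimalImprint C ≐ I[ Ks ]
  optimalImprint-unique C Ks opt =
    (λ (_ , opt′ , r∈) → proj₂ opt′ Ks (proj₁ opt) r∈) ,
    (λ r∈ → Ks , opt , r∈)

  Itriv : Pred Carrier ℓ
  Itriv r = ∃ λ w → r ≤ ρ ｛ w ｝

  record IsBΣ₁Saturated (S : Pred Carrier s) : Set (lsuc 0ℓ ⊔ c ⊔ ℓ ⊔ s) where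
    field
      trivial        : Itriv ⊆ S
      downwardClosed : ∀ {r r′} → r ∈ S → r′ ≤ r → r′ ∈ S
      ⊗-closed       : ∀ {r t} → r ∈ S → t ∈ S → r ⊗ t ∈ S
      ω-closed       : ∀ (B : Pred A 0ℓ) → ρ (B ⊛) ^ω ∈ S

{-# OPTIONS --safe #-}
-- For a list of atoms, each a star B* (B ⊆ A) or an optional letter {ε, a},
-- the product I of the atoms is a downward closed piecewise testable language.
-- A word of I either factors with every atom used "densely" (a star B* by a word
-- of (B⊛)ⁿ with ρ(B⊛)ⁿ = ρ(B⊛)^ω, a letter by itself) or lies in one of finitely
-- many smaller products, in which one atom is replaced by atoms on smaller
-- alphabets. Repeating this from A* yields finitely many products I; the languages
-- "I minus its smaller products" form a BΣ₁-cover, and each of them has an image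
-- below a product of elements ρ(a) and ρ(B⊛)^ω. Conversely, for every k each
-- element of the least saturated set lies below ρ(H) for some nonempty H whose
-- words have the same subwords of length ≤ k, so it lies in the imprint of every
-- BΣ₁-cover. Hence the cover above is optimal and its imprint is the least
-- saturated set.
module Submission where

open import Defs
open import Level using (Level; 0ℓ; _⊔_)
open import Data.Fin.Base using (Fin; zero; suc; toℕ) renaming (_<_ to _<ᶠ_)
open import Data.Fin.Properties using () renaming (_≟_ to _≟ᶠ_; _<?_ to _<?ᶠ_)
open import Data.List.Base
  using (List; []; _∷_; _++_; length; lookup; map; filter; allFin; cartesianProductWith)
open import Data.List.Properties using (++-assoc; ++-identityʳ; filter-notAll; length-++-≤ˡ; length-++-≤ʳ)
open import Data.List.Membership.Propositional using (find; lose) renaming (_∈_ to _∈ˡ_)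
open import Data.List.Membership.Propositional.Properties
  using ( ∈-map⁺; ∈-map⁻; ∈-++⁺ˡ; ∈-++⁺ʳ; ∈-++⁻; ∈-filter⁺; ∈-filter⁻; ∈-allFin
        ; ∈-cartesianProductWith⁺; ∈-cartesianProductWith⁻)
open import Data.List.Relation.Binary.Sublist.Propositional
  using ([]; _∷_; _∷ʳ_; minimum; from∈; ⊆-refl) renaming (_⊆_ to _⊑_)
open import Data.List.Relation.Binary.Sublist.Propositional.Properties using (++⁺; All-resp-⊆)
open import Data.List.Relation.Unary.All as All using (All; []; _∷_)
import Data.List.Relation.Unary.All.Properties as All
open import Data.List.Relation.Unary.Any as Any using (Any; here; there)
import Data.List.Relation.Unary.Any.Properties as Any
open import Data.Nat.Base as ℕ using (ℕ; zero; suc; _+_; _*_; s≤s; z≤n)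
import Data.Nat.Properties as ℕ
open import Data.Product.Base using (∃; ∃₂; _×_; _,_; proj₁; proj₂)
open import Data.Sum.Base using (_⊎_; inj₁; inj₂; [_,_]′)
open import Data.Unit.Base using (⊤; tt)
open import Data.Vec.Functional using (Vector) renaming ([] to []ᵛ; _∷_ to _∷ᵛ_)
open import Function.Base using (_∘_; id)
open import Function.Bundles using (Inverse)
open import Function.Properties.Inverse using (Inverse⇒Injection)
open import Induction.WellFounded using (Acc; acc)
open import Relation.Binary.Definitions using (Decidable; DecidableEquality)
open import Relation.Binary.PropositionalEquality as ≡ using (_≡_; _≗_; setoid)
open import Relation.Nullary.Decidable
  using (Dec; yes; no; ¬?; map′; _×-dec_; decidable-stable; via-injection; ¬¬-excluded-middle)
open import Relation.Nullary.Negation using (¬_; contradiction)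
open import Relation.Unary using (Pred; _∈_; _⊆_; _≐_; ｛_｝; _∩_; ∁)

private
  variable
    c ℓ s : Level
    A : Set

-- Embeddings of subwords

position : {x u : List A} → x ⊑ u → Fin (length x) → Fin (length u)
position (_ ∷ʳ τ) i       = suc (position τ i)
position (_ ∷ τ)  zero    = zero
position (_ ∷ τ)  (suc i) = suc (position τ i)

lookup-position : {x u : List A} (τ : x ⊑ u) (i : Fin (length x)) →
                  lookup u (position τ i) ≡ lookup x i
lookup-position (_ ∷ʳ τ)     i       = lookup-position τ i
lookup-position (≡.refl ∷ τ) zero    = ≡.refl
lookup-position (_ ∷ τ)      (suc i) = lookup-position τ i

position-mono : {x u : List A} (τ : x ⊑ u) (i j : Fin (length x)) →
                i <ᶠ j → position τ i <ᶠ position τ j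
position-mono (_ ∷ʳ τ) i       j       i<j       = s≤s (position-mono τ i j i<j)
position-mono (_ ∷ τ)  zero    (suc j) i<j       = s≤s z≤n
position-mono (_ ∷ τ)  (suc i) (suc j) (s≤s i<j) = s≤s (position-mono τ i j i<j)

position-cancel : {x u : List A} (τ : x ⊑ u) (i j : Fin (length x)) →
                  position τ i <ᶠ position τ j → i <ᶠ j
position-cancel (_ ∷ʳ τ) i       j       (s≤s p) = position-cancel τ i j p
position-cancel (_ ∷ τ)  zero    (suc j) p       = s≤s z≤n
position-cancel (_ ∷ τ)  (suc i) (suc j) (s≤s p) = s≤s (position-cancel τ i j p)

-- One existential witness costs at most one letter, and none when `i` is already hit. The map `f`
-- renames the old positions, so that a valuation into `x` survives the enlargement.
insertPosition : {x u : List A} (τ : x ⊑ u) (i : Fin (length u)) →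
  ∃ λ y → ∃ λ (τ′ : y ⊑ u) → length y ℕ.≤ suc (length x) ×
  (∃ λ j → position τ′ j ≡ i) ×
  (∃ λ (f : Fin (length x) → Fin (length y)) → ∀ k → position τ′ (f k) ≡ position τ k)
insertPosition {u = b ∷ u} (_ ∷ʳ τ) zero =
  _ , ≡.refl ∷ τ , ℕ.≤-refl , (zero , ≡.refl) , suc , λ _ → ≡.refl
insertPosition (b ∷ʳ τ) (suc i) with insertPosition τ i
... | y , τ′ , len , (j , j≡) , f , f≡ =
  y , b ∷ʳ τ′ , len , (j , ≡.cong suc j≡) , f , λ k → ≡.cong suc (f≡ k)
insertPosition (p ∷ τ) zero =
  _ , p ∷ τ , ℕ.n≤1+n _ , (zero , ≡.refl) , id , λ _ → ≡.refl
insertPosition (p ∷ τ) (suc i) with insertPosition τ i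
... | y , τ′ , len , (j , j≡) , f , f≡ =
  _ , p ∷ τ′ , s≤s len , (suc j , ≡.cong suc j≡) ,
  (λ { zero → zero ; (suc k) → suc (f k) }) ,
  (λ { zero → ≡.refl ; (suc k) → ≡.cong suc (f≡ k) })

positive⇒suc : ∀ {n} (k : Fin (suc n)) → 0 ℕ.< toℕ k → ∃ λ k′ → k ≡ suc k′
positive⇒suc (suc k) _ = k , ≡.refl

-- The first letter of `w` is hit either by the first position of `v` or, by monotonicity, by no
-- position; in both cases the rest of `f` shifts down into the tail of `w`.
embedding⇒⊑ : (v w : List A) (f : Fin (length v) → Fin (length w)) →
              (∀ i j → i <ᶠ j → f i <ᶠ f j) →
              (∀ i → lookup w (f i) ≡ lookup v i) → v ⊑ w
embedding⇒⊑ []      w       f mono lab = minimum w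
embedding⇒⊑ (a ∷ v) []      f mono lab with () ← f zero
embedding⇒⊑ (a ∷ v) (b ∷ w) f mono lab = byFirst (f zero) ≡.refl
  where
  inTail : ∀ v (f : Fin (length v) → Fin (length (b ∷ w))) →
           (∀ i j → i <ᶠ j → f i <ᶠ f j) →
           (∀ i → lookup (b ∷ w) (f i) ≡ lookup v i) →
           (∀ i → 0 ℕ.< toℕ (f i)) → v ⊑ w
  inTail v f mono lab pos = embedding⇒⊑ v w g
    (λ i j i<j → ℕ.s<s⁻¹ (≡.subst₂ _<ᶠ_ (g≡ i) (g≡ j) (mono i j i<j)))
    (λ i → ≡.trans (≡.cong (lookup (b ∷ w)) (≡.sym (g≡ i))) (lab i))
    where
    g : Fin (length v) → Fin (length w)
    g i = proj₁ (positive⇒suc (f i) (pos i))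
    g≡ : ∀ i → f i ≡ suc (g i)
    g≡ i = proj₂ (positive⇒suc (f i) (pos i))

  byFirst : ∀ k → f zero ≡ k → a ∷ v ⊑ b ∷ w
  byFirst zero eq =
    ≡.sym (≡.trans (≡.cong (lookup (b ∷ w)) (≡.sym eq)) (lab zero)) ∷
    inTail v (f ∘ suc) (λ i j i<j → mono (suc i) (suc j) (s≤s i<j)) (lab ∘ suc)
      (λ i → ℕ.≤-<-trans z≤n (mono zero (suc i) (s≤s z≤n)))
  byFirst (suc k) eq = b ∷ʳ inTail (a ∷ v) f mono lab pos
    where
    pos₀ : 0 ℕ.< toℕ (f zero)
    pos₀ = ≡.subst (λ k → 0 ℕ.< toℕ k) (≡.sym eq) (s≤s z≤n)
    pos : ∀ i → 0 ℕ.< toℕ (f i)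
    pos zero    = pos₀
    pos (suc i) = ℕ.<-trans pos₀ (mono zero (suc i) (s≤s z≤n))

⊑-++⁻ : (u v : List A) {x : List A} → x ⊑ u ++ v →
        ∃₂ λ y z → x ≡ y ++ z × y ⊑ u × z ⊑ v
⊑-++⁻ []      v τ = [] , _ , ≡.refl , [] , τ
⊑-++⁻ (a ∷ u) v (_ ∷ʳ τ) with ⊑-++⁻ u v τ
... | y , z , x≡ , σ , σ′ = y , z , x≡ , a ∷ʳ σ , σ′
⊑-++⁻ (a ∷ u) v (≡.refl ∷ τ) with ⊑-++⁻ u v τ
... | y , z , ≡.refl , σ , σ′ = a ∷ y , z , ≡.refl , ≡.refl ∷ σ , σ′

-- Preservation of formulas

-- An embedding preserves and reflects order and labels. Both directions go in one induction because
-- negation exchanges them.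
IsQuantifierFree-position : ∀ {n} {φ : Formula A n} → IsQuantifierFree φ →
  ∀ {x u} (τ : x ⊑ u) {ν ν′} → ν′ ≗ position τ ∘ ν →
  (Sat x ν φ → Sat u ν′ φ) × (Sat u ν′ φ → Sat x ν φ)
IsQuantifierFree-position true τ ν≗ = id , id
IsQuantifierFree-position (P a i) {u = u} τ {ν} ν≗ = ≡.trans eq , ≡.trans (≡.sym eq)
  where
  eq = ≡.trans (≡.cong (lookup u) (ν≗ i)) (lookup-position τ (ν i))
IsQuantifierFree-position (i ≺ j) τ {ν} ν≗ =
  ≡.subst₂ _<ᶠ_ (≡.sym (ν≗ i)) (≡.sym (ν≗ j)) ∘ position-mono τ (ν i) (ν j) ,
  position-cancel τ (ν i) (ν j) ∘ ≡.subst₂ _<ᶠ_ (ν≗ i) (ν≗ j)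
IsQuantifierFree-position (not qf) τ ν≗ with IsQuantifierFree-position qf τ ν≗
... | to , from = (λ ¬s → ¬s ∘ from) , (λ ¬s → ¬s ∘ to)
IsQuantifierFree-position (qf and qf′) τ ν≗
  with IsQuantifierFree-position qf τ ν≗ | IsQuantifierFree-position qf′ τ ν≗
... | to , from | to′ , from′ =
  (λ (s , s′) → to s , to′ s′) , (λ (s , s′) → from s , from′ s′)
IsQuantifierFree-position (qf or qf′) τ ν≗
  with IsQuantifierFree-position qf τ ν≗ | IsQuantifierFree-position qf′ τ ν≗
... | to , from | to′ , from′ =
  [ inj₁ ∘ to , inj₂ ∘ to′ ]′ , [ inj₁ ∘ from , inj₂ ∘ from′ ]′

∷ᵛ-≗ : ∀ {m n k} (f : Fin m → Fin n) {ν : Vector (Fin m) k} {ν′} {i i′} →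
       i′ ≡ f i → ν′ ≗ f ∘ ν → (i′ ∷ᵛ ν′) ≗ f ∘ (i ∷ᵛ ν)
∷ᵛ-≗ f p q zero    = p
∷ᵛ-≗ f p q (suc k) = q k

IsΣ₁-preserved : ∀ {n} {φ : Formula A n} → IsΣ₁ φ →
  ∀ {x u} (τ : x ⊑ u) {ν ν′} → ν′ ≗ position τ ∘ ν → Sat x ν φ → Sat u ν′ φ
IsΣ₁-preserved (matrix qf) τ ν≗ = proj₁ (IsQuantifierFree-position qf τ ν≗)
IsΣ₁-preserved (exists σ₁) τ ν≗ (i , sat) =
  position τ i , IsΣ₁-preserved σ₁ τ (∷ᵛ-≗ (position τ) ≡.refl ν≗) sat

quantifiers : ∀ {n} {φ : Formula A n} → IsΣ₁ φ → ℕ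
quantifiers (matrix _)  = 0
quantifiers (exists σ₁) = suc (quantifiers σ₁)

-- Each quantifier inserts its witness into the subword. The renaming `f` carries a witness chosen
-- early through the later insertions; `μ` ranges over all pointwise matching valuations, since
-- valuations are functions and are compared by `≗` only.
IsΣ₁-smallModel : ∀ {n} {φ : Formula A n} (σ₁ : IsΣ₁ φ) →
  ∀ {x u} (τ : x ⊑ u) {ν ν′} → ν′ ≗ position τ ∘ ν → Sat u ν′ φ →
  ∃ λ y → ∃ λ (τ′ : y ⊑ u) → length y ℕ.≤ length x + quantifiers σ₁ ×
  (∃ λ (f : Fin (length x) → Fin (length y)) → ∀ k → position τ′ (f k) ≡ position τ k) ×
  (∀ {μ} → ν′ ≗ position τ′ ∘ μ → Sat y μ φ)
IsΣ₁-smallModel (matrix qf) {x} τ ν≗ sat =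
  x , τ , ℕ.m≤m+n _ 0 , (id , λ _ → ≡.refl) ,
  λ μ≗ → proj₂ (IsQuantifierFree-position qf τ μ≗) sat
IsΣ₁-smallModel (exists σ₁) {x} τ {ν} {ν′} ν≗ (i , sat)
  with insertPosition τ i
... | x₁ , τ₁ , len₁ , (j , j≡) , f₁ , f₁≡
  with IsΣ₁-smallModel σ₁ τ₁ {ν = j ∷ᵛ f₁ ∘ ν} {ν′ = i ∷ᵛ ν′}
         (∷ᵛ-≗ (position τ₁) (≡.sym j≡) (λ k → ≡.trans (ν≗ k) (≡.sym (f₁≡ (ν k))))) sat
... | y , τ₂ , len₂ , (f₂ , f₂≡) , sat₂ =
  y , τ₂ ,
  ℕ.≤-trans len₂ (ℕ.≤-trans (ℕ.+-monoˡ-≤ (quantifiers σ₁) len₁)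
                            (ℕ.≤-reflexive (≡.sym (ℕ.+-suc (length x) _)))) ,
  (f₂ ∘ f₁ , λ k → ≡.trans (f₂≡ (f₁ k)) (f₁≡ k)) ,
  λ μ≗ → f₂ j , sat₂ (∷ᵛ-≗ (position τ₂) (≡.sym (≡.trans (f₂≡ j) j≡)) μ≗)

-- Simon's congruence

infix 4 _≲[_]_
_≲[_]_ : List A → ℕ → List A → Set
u ≲[ k ] v = ∀ {x} → length x ℕ.≤ k → x ⊑ u → x ⊑ v

≲-++ : ∀ {k} {u u′ v v′ : List A} → u ≲[ k ] v → u′ ≲[ k ] v′ → u ++ u′ ≲[ k ] v ++ v′
≲-++ {u = u} {u′} u≲v u′≲v′ len τ with ⊑-++⁻ u u′ τ
... | y , z , ≡.refl , σ , σ′ =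
  ++⁺ (u≲v (ℕ.≤-trans (length-++-≤ˡ y) len) σ) (u′≲v′ (ℕ.≤-trans (length-++-≤ʳ z {y}) len) σ′)

-- Starting from the empty subword, a model inside `u` takes at most one letter per quantifier. This
-- short subword also embeds in `v`, and existential sentences are preserved upwards.
IsΣ₁-≲ : {φ : Sentence A} (σ₁ : IsΣ₁ φ) {u v : List A} →
         u ≲[ quantifiers σ₁ ] v → ⟦ φ ⟧ u → ⟦ φ ⟧ v
IsΣ₁-≲ σ₁ {u} u≲v sat
  with IsΣ₁-smallModel σ₁ (minimum u) {ν = []ᵛ} (λ ()) sat
... | y , τ , len , _ , sat′ =
  IsΣ₁-preserved σ₁ (u≲v len τ) (λ ()) (sat′ {μ = []ᵛ} (λ ()))

rank : {φ : Sentence A} → IsBΣ₁ φ → ℕ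
rank (base σ₁) = quantifiers σ₁
rank (not b)   = rank b
rank (b and d) = rank b ℕ.⊔ rank d
rank (b or d)  = rank b ℕ.⊔ rank d

-- Negation exchanges `u` and `v`, hence the two inequalities among the hypotheses.
IsBΣ₁-≲ : {φ : Sentence A} (b : IsBΣ₁ φ) {k : ℕ} → rank b ℕ.≤ k → {u v : List A} →
          u ≲[ k ] v → v ≲[ k ] u → ⟦ φ ⟧ u → ⟦ φ ⟧ v
IsBΣ₁-≲ (base σ₁) r u≲v v≲u sat = IsΣ₁-≲ σ₁ (λ len → u≲v (ℕ.≤-trans len r)) sat
IsBΣ₁-≲ (not b)   r u≲v v≲u ¬sat = ¬sat ∘ IsBΣ₁-≲ b r v≲u u≲v
IsBΣ₁-≲ (b and d) r u≲v v≲u (s , t) =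
  IsBΣ₁-≲ b (ℕ.m⊔n≤o⇒m≤o _ _ r) u≲v v≲u s , IsBΣ₁-≲ d (ℕ.m⊔n≤o⇒n≤o _ _ r) u≲v v≲u t
IsBΣ₁-≲ (b or d)  r u≲v v≲u =
  [ inj₁ ∘ IsBΣ₁-≲ b (ℕ.m⊔n≤o⇒m≤o _ _ r) u≲v v≲u
  , inj₂ ∘ IsBΣ₁-≲ d (ℕ.m⊔n≤o⇒n≤o _ _ r) u≲v v≲u ]′

-- The unions of classes of Simon's congruence of level `k`.
SimonClosed : ℕ → Language A → Set
SimonClosed k K = ∀ u v → u ≲[ k ] v → v ≲[ k ] u → u ∈ K → v ∈ K

SimonClosed-mono : ∀ {j k} → j ℕ.≤ k → {K : Language A} → SimonClosed j K → SimonClosed k K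
SimonClosed-mono j≤k sat u v u≲v v≲u =
  sat u v (λ len → u≲v (ℕ.≤-trans len j≤k)) (λ len → v≲u (ℕ.≤-trans len j≤k))

BΣ₁⇒SimonClosed : {K : Language A} → BΣ₁ K → ∃ λ k → SimonClosed k K
BΣ₁⇒SimonClosed (φ , b , K⊆ , ⊆K) = rank b , λ u v u≲v v≲u →
  ⊆K ∘ IsBΣ₁-≲ b ℕ.≤-refl u≲v v≲u ∘ K⊆

All-BΣ₁⇒SimonClosed : {Ks : List (Language A)} → All BΣ₁ Ks → ∃ λ k → All (SimonClosed k) Ks
All-BΣ₁⇒SimonClosed [] = 0 , []
All-BΣ₁⇒SimonClosed (b ∷ bs) with BΣ₁⇒SimonClosed b | All-BΣ₁⇒SimonClosed bs
... | j , sat | k , sats = j ℕ.⊔ k ,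
  SimonClosed-mono (ℕ.m≤m⊔n j k) sat ∷ All.map (SimonClosed-mono (ℕ.m≤n⊔m j k)) sats

-- Closure properties of BΣ₁

BΣ₁-∁ : {L : Language A} → BΣ₁ L → BΣ₁ (∁ L)
BΣ₁-∁ (φ , b , L⊆ , ⊆L) = not φ , not b , (λ ¬l → ¬l ∘ ⊆L) , (λ ¬s → ¬s ∘ L⊆)

BΣ₁-∩ : {K L : Language A} → BΣ₁ K → BΣ₁ L → BΣ₁ (K ∩ L)
BΣ₁-∩ (φ , b , K⊆ , ⊆K) (ψ , d , L⊆ , ⊆L) =
  φ and ψ , b and d , (λ (k , l) → K⊆ k , L⊆ l) , (λ (s , t) → ⊆K s , ⊆L t)

BΣ₁-resp-≐ : {K L : Language A} → K ≐ L → BΣ₁ L → BΣ₁ K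
BΣ₁-resp-≐ (K⊆L , L⊆K) (φ , b , L⊆ , ⊆L) = φ , b , L⊆ ∘ K⊆L , L⊆K ∘ ⊆L

BΣ₁-All : {X : Set} {L : X → Language A} → (∀ x → BΣ₁ (L x)) →
          ∀ xs → BΣ₁ (λ w → All (λ x → L x w) xs)
BΣ₁-All bL []       = true , base (matrix true) , (λ _ → tt) , (λ _ → [])
BΣ₁-All bL (x ∷ xs) = BΣ₁-resp-≐ ((λ { (p ∷ ps) → p , ps }) , (λ (p , ps) → p ∷ ps))
                                 (BΣ₁-∩ (bL x) (BΣ₁-All bL xs))

existsAll : ∀ n → Formula A n → Sentence A
existsAll zero    φ = φ
existsAll (suc n) φ = existsAll n (exists φ)

existsAll-IsΣ₁ : ∀ n {φ : Formula A n} → IsΣ₁ φ → IsΣ₁ (existsAll n φ)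
existsAll-IsΣ₁ zero    σ₁ = σ₁
existsAll-IsΣ₁ (suc n) σ₁ = existsAll-IsΣ₁ n (exists σ₁)

existsAll⁻ : ∀ n {φ : Formula A n} {w} → ⟦ existsAll n φ ⟧ w → ∃ λ ν → Sat w ν φ
existsAll⁻ zero    sat = []ᵛ , sat
existsAll⁻ (suc n) sat with existsAll⁻ n sat
... | ν , i , sat′ = i ∷ᵛ ν , sat′

position-refl : (w : List A) (i : Fin (length w)) → position (⊆-refl {x = w}) i ≡ i
position-refl (_ ∷ _) zero    = ≡.refl
position-refl (_ ∷ w) (suc i) = ≡.cong suc (position-refl w i)

IsΣ₁-resp-≗ : ∀ {n} {φ : Formula A n} → IsΣ₁ φ → ∀ {w ν ν′} → ν ≗ ν′ →
              Sat w ν φ → Sat w ν′ φ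
IsΣ₁-resp-≗ σ₁ {w} {ν} {ν′} ν≗ν′ = IsΣ₁-preserved σ₁ (⊆-refl {x = w}) {ν} {ν′}
  (λ i → ≡.trans (≡.sym (ν≗ν′ i)) (≡.sym (position-refl w (ν i))))

existsAll⁺ : ∀ n {φ : Formula A n} → IsΣ₁ φ → ∀ {w} ν → Sat w ν φ → ⟦ existsAll n φ ⟧ w
existsAll⁺ zero    σ₁ ν sat = IsΣ₁-resp-≗ σ₁ (λ ()) sat
existsAll⁺ (suc n) σ₁ ν sat = existsAll⁺ n (exists σ₁) (ν ∘ suc)
  (ν zero , IsΣ₁-resp-≗ σ₁ (λ { zero → ≡.refl ; (suc _) → ≡.refl }) sat)

conj : ∀ {n} {X : Set} → (X → Formula A n) → List X → Formula A n
conj φ []       = true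
conj φ (x ∷ xs) = φ x and conj φ xs

conj-IsQuantifierFree : ∀ {n} {X : Set} {φ : X → Formula A n} →
  (∀ x → IsQuantifierFree (φ x)) → ∀ xs → IsQuantifierFree (conj φ xs)
conj-IsQuantifierFree qf []       = true
conj-IsQuantifierFree qf (x ∷ xs) = qf x and conj-IsQuantifierFree qf xs

conj⁻ : ∀ {n} {X : Set} {φ : X → Formula A n} {w ν} {xs} →
        Sat w ν (conj φ xs) → ∀ {x} → x ∈ˡ xs → Sat w ν (φ x)
conj⁻ {xs = _ ∷ _} (s , _) (here ≡.refl) = s
conj⁻ {xs = _ ∷ _} (_ , t) (there x∈)    = conj⁻ t x∈

conj⁺ : ∀ {n} {X : Set} {φ : X → Formula A n} {w ν} xs →
        (∀ x → Sat w ν (φ x)) → Sat w ν (conj φ xs)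
conj⁺ []       f = tt
conj⁺ (x ∷ xs) f = f x , conj⁺ xs f

module _ (v : List A) where

  private
    n = length v

  orderFormula : Fin n × Fin n → Formula A n
  orderFormula (i , j) with i <?ᶠ j
  ... | yes _ = i ≺ j
  ... | no _  = true

  -- The positive diagram of `v`: the valuations in `w` that satisfy it are the embeddings of `v`
  -- into `w`. Pairs that are not increasing contribute only `true`.
  diagram : Formula A n
  diagram = conj (λ i → P (lookup v i) i) (allFin n) and
            conj orderFormula (cartesianProductWith _,_ (allFin n) (allFin n))

  diagram-IsQuantifierFree : IsQuantifierFree diagram
  diagram-IsQuantifierFree =
    conj-IsQuantifierFree (λ i → P _ i) _ and conj-IsQuantifierFree order _
    where
    order : ∀ p → IsQuantifierFree (orderFormula p)
    order (i , j) with i <?ᶠ j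
    ... | yes _ = i ≺ j
    ... | no _  = true

  diagram-self : Sat v id diagram
  diagram-self = conj⁺ _ (λ _ → ≡.refl) , conj⁺ _ order
    where
    order : ∀ p → Sat v id (orderFormula p)
    order (i , j) with i <?ᶠ j
    ... | yes i<j = i<j
    ... | no _    = tt

  diagram⇒⊑ : ∀ {w ν} → Sat w ν diagram → v ⊑ w
  diagram⇒⊑ {w} {ν} (labels , orders) = embedding⇒⊑ v w ν
    (λ i j i<j → order i<j
      (conj⁻ orders (∈-cartesianProductWith⁺ _,_ (∈-allFin i) (∈-allFin j))))
    (λ i → conj⁻ labels (∈-allFin i))
    where
    order : ∀ {i j} → i <ᶠ j → Sat w ν (orderFormula (i , j)) → ν i <ᶠ ν j
    order {i} {j} i<j sat with i <?ᶠ j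
    ... | yes _  = sat
    ... | no i≮j = contradiction i<j i≮j

  BΣ₁-⊑ : BΣ₁ (v ⊑_)
  BΣ₁-⊑ = existsAll n diagram , base (existsAll-IsΣ₁ n σ₁) ,
    (λ τ → existsAll⁺ n σ₁ (position τ) (IsΣ₁-preserved σ₁ τ (λ _ → ≡.refl) diagram-self)) ,
    (λ sat → diagram⇒⊑ (proj₂ (existsAll⁻ n sat)))
    where
    σ₁ = matrix diagram-IsQuantifierFree

-- Powers of languages

infixl 8 _^ᴸ_
_^ᴸ_ : Language A → ℕ → Language A
L ^ᴸ zero  = ｛ [] ｝
L ^ᴸ suc n = L · (L ^ᴸ n)

^ᴸ-snoc : {L : Language A} (n : ℕ) {u v : List A} →
          u ∈ L ^ᴸ n → v ∈ L → u ++ v ∈ L ^ᴸ suc n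
^ᴸ-snoc zero    {v = v} ≡.refl v∈ = v , [] , ≡.sym (++-identityʳ v) , v∈ , ≡.refl
^ᴸ-snoc (suc n) {v = v} (x , y , ≡.refl , x∈ , y∈) v∈ =
  x , y ++ v , ++-assoc x y v , x∈ , ^ᴸ-snoc n y∈ v∈

^ᴸ-nonempty : {L : Language A} (n : ℕ) → ∃ L → ∃ (L ^ᴸ n)
^ᴸ-nonempty zero    _        = [] , ≡.refl
^ᴸ-nonempty (suc n) (w , w∈) with ^ᴸ-nonempty n (w , w∈)
... | v , v∈ = w ++ v , w , v , ≡.refl , w∈ , v∈

⊛^ᴸ⇒All : {B : Pred A 0ℓ} (n : ℕ) {w : List A} → w ∈ (B ⊛) ^ᴸ n → All B w
⊛^ᴸ⇒All zero    ≡.refl = []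
⊛^ᴸ⇒All (suc n) (u , v , ≡.refl , u∈ , v∈) =
  All.++⁺ (All.tabulate (proj₁ u∈)) (⊛^ᴸ⇒All n v∈)

-- Each of the `n` factors contains all letters of `B` and so can supply one letter of `x`.
⊛^ᴸ⇒⊒ : {B : Pred A 0ℓ} (n : ℕ) {w x : List A} → w ∈ (B ⊛) ^ᴸ n →
        All B x → length x ℕ.≤ n → x ⊑ w
⊛^ᴸ⇒⊒ n       _  []       _       = minimum _
⊛^ᴸ⇒⊒ (suc n) (u , v , ≡.refl , u∈ , v∈) (b ∷ bs) (s≤s len) =
  ++⁺ (from∈ (proj₂ u∈ b)) (⊛^ᴸ⇒⊒ n v∈ bs len)

-- From `k` factors on, the subwords of length at most `k` are all words over `B` of such length,
-- whichever word of the power is taken.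
⊛^ᴸ-≲ : {B : Pred A 0ℓ} {k n : ℕ} → k ℕ.≤ n → {u v : List A} →
        u ∈ (B ⊛) ^ᴸ n → v ∈ (B ⊛) ^ᴸ n → u ≲[ k ] v
⊛^ᴸ-≲ {n = n} k≤n u∈ v∈ len τ =
  ⊛^ᴸ⇒⊒ n v∈ (All-resp-⊆ τ (⊛^ᴸ⇒All n u∈)) (ℕ.≤-trans len k≤n)

-- Products of atoms

data Atom (A : Set) : Set where
  star : List A → Atom A
  opt  : A → Atom A

infix 4 _∈ᴵ_
-- `skip` ends the reading of a star and also leaves an optional letter out.
data _∈ᴵ_ {A : Set} : List A → List (Atom A) → Set where
  []   : [] ∈ᴵ []
  skip : ∀ {w X I} → w ∈ᴵ I → w ∈ᴵ X ∷ I
  loop : ∀ {b B w I} → b ∈ˡ B → w ∈ᴵ star B ∷ I → b ∷ w ∈ᴵ star B ∷ I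
  use  : ∀ {a w I} → w ∈ᴵ I → a ∷ w ∈ᴵ opt a ∷ I

[]∈ᴵ : (I : List (Atom A)) → [] ∈ᴵ I
[]∈ᴵ []      = []
[]∈ᴵ (_ ∷ I) = skip ([]∈ᴵ I)

∈ᴵ-resp-⊑ : ∀ {x w : List A} {I} → x ⊑ w → w ∈ᴵ I → x ∈ᴵ I
∈ᴵ-resp-⊑ []               w∈         = w∈
∈ᴵ-resp-⊑ τ@(_ ∷ʳ _)       (skip w∈)  = skip (∈ᴵ-resp-⊑ τ w∈)
∈ᴵ-resp-⊑ τ@(_ ∷ _)        (skip w∈)  = skip (∈ᴵ-resp-⊑ τ w∈)
∈ᴵ-resp-⊑ (_ ∷ʳ τ)         (loop b w∈) = ∈ᴵ-resp-⊑ τ w∈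
∈ᴵ-resp-⊑ (≡.refl ∷ τ)     (loop b w∈) = loop b (∈ᴵ-resp-⊑ τ w∈)
∈ᴵ-resp-⊑ (_ ∷ʳ τ)         (use w∈)   = skip (∈ᴵ-resp-⊑ τ w∈)
∈ᴵ-resp-⊑ (≡.refl ∷ τ)     (use w∈)   = use (∈ᴵ-resp-⊑ τ w∈)

∈ᴵ-++ : ∀ {u v : List A} {I J} → u ∈ᴵ I → v ∈ᴵ J → u ++ v ∈ᴵ I ++ J
∈ᴵ-++ []          v∈ = v∈
∈ᴵ-++ (skip u∈)   v∈ = skip (∈ᴵ-++ u∈ v∈)
∈ᴵ-++ (loop b u∈) v∈ = loop b (∈ᴵ-++ u∈ v∈)
∈ᴵ-++ (use u∈)    v∈ = use (∈ᴵ-++ u∈ v∈)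

∈ᴵ-∷⁻ : ∀ {w : List A} {X I} → w ∈ᴵ X ∷ I →
        ∃₂ λ u v → w ≡ u ++ v × u ∈ᴵ X ∷ [] × v ∈ᴵ I
∈ᴵ-∷⁻ {w = w} (skip w∈) = [] , w , ≡.refl , skip [] , w∈
∈ᴵ-∷⁻ (loop b w∈) with ∈ᴵ-∷⁻ w∈
... | u , v , ≡.refl , u∈ , v∈ = _ ∷ u , v , ≡.refl , loop b u∈ , v∈
∈ᴵ-∷⁻ (use w∈) = _ ∷ [] , _ , ≡.refl , use [] , w∈

∈-star⁺ : ∀ {B w : List A} → All (_∈ˡ B) w → w ∈ᴵ star B ∷ []
∈-star⁺ []       = skip []
∈-star⁺ (b ∷ bs) = loop b (∈-star⁺ bs)

∈-star⁻ : ∀ {B w : List A} → w ∈ᴵ star B ∷ [] → All (_∈ˡ B) w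
∈-star⁻ (skip [])   = []
∈-star⁻ (loop b w∈) = b ∷ ∈-star⁻ w∈

-- Excluded middle is used under double negation, once for each letter of `as`; `B` itself comes
-- without a decision procedure.
¬¬-enumeration : (B : Pred A 0ℓ) (as : List A) →
  ¬ ¬ (∃ λ bs → All B bs × (∀ {a} → a ∈ˡ as → B a → a ∈ˡ bs))
¬¬-enumeration B []       k = k ([] , [] , λ ())
¬¬-enumeration B (a ∷ as) k =
  ¬¬-enumeration B as λ (bs , bs⊆B , B⊆bs) → ¬¬-excluded-middle λ
    { (yes Ba) → k (a ∷ bs , Ba ∷ bs⊆B , λ { (here ≡.refl) _ → here ≡.refl
                                           ; (there a∈) Bx → there (B⊆bs a∈ Bx) })
    ; (no ¬Ba) → k (bs , bs⊆B , λ { (here ≡.refl) Ba → contradiction Ba ¬Ba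
                                  ; (there a∈) Bx → B⊆bs a∈ Bx }) }

-- Decidable membership and forbidden subwords of products

module _ {A : Set} (_≟_ : DecidableEquality A) where

  open import Data.List.Membership.DecPropositional _≟_ using (_∈?_)

  _∈ᴵ?_ : Decidable (_∈ᴵ_ {A})
  []      ∈ᴵ? I            = yes ([]∈ᴵ I)
  (b ∷ w) ∈ᴵ? []           = no λ ()
  (b ∷ w) ∈ᴵ? (X ∷ I) with (b ∷ w) ∈ᴵ? I
  ... | yes w∈ = yes (skip w∈)
  (b ∷ w) ∈ᴵ? (star B ∷ I) | no w∉ =
    map′ (λ (b∈ , w∈) → loop b∈ w∈)
         (λ { (skip w∈) → contradiction w∈ w∉ ; (loop b∈ w∈) → b∈ , w∈ })
         ((b ∈? B) ×-dec (w ∈ᴵ? (star B ∷ I)))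
  (b ∷ w) ∈ᴵ? (opt a ∷ I)  | no w∉ =
    map′ (λ { (≡.refl , w∈) → use w∈ })
         (λ { (skip w∈) → contradiction w∈ w∉ ; (use w∈) → ≡.refl , w∈ })
         ((b ≟ a) ×-dec (w ∈ᴵ? I))

  Forbidden : List A → List (Atom A) → Set
  Forbidden w I = ∃ λ x → x ⊑ w × length x ℕ.≤ suc (length I) × ¬ x ∈ᴵ I

  -- When `X` cannot read `b`, no word starting with `b` gains from `X`. A forbidden subword of `I`
  -- that avoids the leading `b` gets `b` prefixed, so that `X` cannot read its start; the longer
  -- product pays for this letter.
  Forbidden-skip : ∀ {b w X I} → (∀ {v} → b ∷ v ∈ᴵ X ∷ I → b ∷ v ∈ᴵ I) →
                   Forbidden (b ∷ w) I → Forbidden (b ∷ w) (X ∷ I)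
  Forbidden-skip unskip (x , _ ∷ʳ τ , len , x∉) =
    _ ∷ x , ≡.refl ∷ τ , s≤s len , λ bx∈ → x∉ (∈ᴵ-resp-⊑ (_ ∷ʳ ⊆-refl) (unskip bx∈))
  Forbidden-skip unskip (_ , ≡.refl ∷ τ , len , x∉) =
    _ , ≡.refl ∷ τ , ℕ.m≤n⇒m≤1+n len , x∉ ∘ unskip

  -- Greedy reading from the left: leaving an atom behind costs at most one letter, letters absorbed
  -- by a star cost nothing, and one more letter remains when the product is exhausted. Hence the
  -- bound `suc (length I)`.
  forbiddenSubword : ∀ I w → ¬ w ∈ᴵ I → Forbidden w I
  forbiddenSubword []      []      w∉ = contradiction [] w∉
  forbiddenSubword []      (b ∷ w) w∉ = b ∷ [] , ≡.refl ∷ minimum w , ℕ.≤-refl , λ ()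
  forbiddenSubword (star B ∷ I) = inStar
    where
    inStar : ∀ w → ¬ w ∈ᴵ star B ∷ I → Forbidden w (star B ∷ I)
    inStar []      w∉ = contradiction ([]∈ᴵ _) w∉
    inStar (b ∷ w) w∉ with b ∈? B
    ... | yes b∈ =
      let x , τ , len , x∉ = inStar w (w∉ ∘ loop b∈)
      in x , b ∷ʳ τ , len , x∉
    ... | no b∉ = Forbidden-skip
      (λ { (skip v∈) → v∈ ; (loop b∈ _) → contradiction b∈ b∉ })
      (forbiddenSubword I (b ∷ w) (w∉ ∘ skip))
  forbiddenSubword (opt a ∷ I) []      w∉ = contradiction ([]∈ᴵ _) w∉
  forbiddenSubword (opt a ∷ I) (b ∷ w) w∉ with b ≟ a
  ... | yes ≡.refl =
    let x , τ , len , x∉ = forbiddenSubword I w (w∉ ∘ use)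
    in b ∷ x , ≡.refl ∷ τ , s≤s len ,
       λ { (skip x∈) → x∉ (∈ᴵ-resp-⊑ (b ∷ʳ ⊆-refl) x∈) ; (use x∈) → x∉ x∈ }
  ... | no b≢a = Forbidden-skip
    (λ { (skip v∈) → v∈ ; (use _) → contradiction ≡.refl b≢a })
    (forbiddenSubword I (b ∷ w) (w∉ ∘ skip))

  module _ (letters : List A) (letters-complete : ∀ a → a ∈ˡ letters) where

    words≤ : ℕ → List (List A)
    words≤ zero    = [] ∷ []
    words≤ (suc n) = [] ∷ cartesianProductWith _∷_ letters (words≤ n)

    ∈-words≤ : ∀ n {w} → length w ℕ.≤ n → w ∈ˡ words≤ n
    ∈-words≤ zero    {[]}    _       = here ≡.refl
    ∈-words≤ (suc n) {[]}    _       = here ≡.refl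
    ∈-words≤ (suc n) {a ∷ w} (s≤s l) =
      there (∈-cartesianProductWith⁺ _∷_ (letters-complete a) (∈-words≤ n l))

    -- Downward closure and short forbidden subwords make a product the set of words avoiding
    -- finitely many subwords.
    BΣ₁-∈ᴵ : ∀ I → BΣ₁ (_∈ᴵ I)
    BΣ₁-∈ᴵ I = BΣ₁-resp-≐ (avoids , avoiding) (BΣ₁-All (BΣ₁-∁ ∘ BΣ₁-⊑) forbidden)
      where
      forbidden : List (List A)
      forbidden = filter (λ x → ¬? (x ∈ᴵ? I)) (words≤ (suc (length I)))
      avoids : (_∈ᴵ I) ⊆ λ w → All (λ x → ¬ x ⊑ w) forbidden
      avoids w∈ = All.tabulate λ x∈ τ →
        proj₂ (∈-filter⁻ (λ x → ¬? (x ∈ᴵ? I)) {xs = words≤ (suc (length I))} x∈) (∈ᴵ-resp-⊑ τ w∈)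
      avoiding : (λ w → All (λ x → ¬ x ⊑ w) forbidden) ⊆ (_∈ᴵ I)
      avoiding {w} ps = decidable-stable (w ∈ᴵ? I) λ w∉ →
        let x , τ , len , x∉ = forbiddenSubword I w w∉
        in All.lookup ps (∈-filter⁺ (λ x → ¬? (x ∈ᴵ? I)) (∈-words≤ _ len) x∉) τ

  -- Splitting a star into dense words and smaller products

  _without_ : List A → A → List A
  B without a = filter (λ b → ¬? (b ≟ a)) B

  length-without : ∀ {a B} → a ∈ˡ B → length (B without a) ℕ.< length B
  length-without {a} {B} a∈ =
    filter-notAll _ B (lose a∈ λ a≢a → a≢a ≡.refl)

  ∈-without : ∀ {a b B w} → b ∈ˡ w → ¬ a ∈ˡ w → b ∈ˡ B → b ∈ˡ B without a
  ∈-without b∈w a∉w b∈B = ∈-filter⁺ _ b∈B λ { ≡.refl → a∉w b∈w }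

  missesLetter : {a : A} {B w : List A} → All (_∈ˡ B) w → ¬ a ∈ˡ w → w ∈ᴵ star (B without a) ∷ []
  missesLetter ⊆B a∉ = ∈-star⁺ (All.tabulate λ b∈ → ∈-without b∈ a∉ (All.lookup ⊆B b∈))

  full? : (B w : List A) → All (_∈ˡ w) B ⊎ ∃ λ a → a ∈ˡ B × ¬ a ∈ˡ w
  full? B w with All.all? (_∈? w) B
  ... | yes full = inj₁ full
  ... | no ¬full = inj₂ (find (All.¬All⇒Any¬ (_∈? w) B ¬full))

  -- The word is scanned from the right until all letters of `B` have occurred; the letter `a` that
  -- completes them cannot occur in `v`. For empty `B` there is no such letter, hence the separate
  -- outcome.
  shortestFullSuffix : (B w : List A) → All (_∈ˡ B) w →
    (∃ λ a → a ∈ˡ B × ¬ a ∈ˡ w) ⊎ B ≡ [] ⊎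
    ∃₂ λ u a → ∃ λ v → w ≡ u ++ a ∷ v × a ∈ˡ B × ¬ a ∈ˡ v × All (_∈ˡ a ∷ v) B
  shortestFullSuffix []      _ _ = inj₂ (inj₁ ≡.refl)
  shortestFullSuffix (b ∷ B) []      []       = inj₁ (b , here ≡.refl , λ ())
  shortestFullSuffix B@(_ ∷ _) (x ∷ w) (x∈ ∷ ⊆B) with shortestFullSuffix B w ⊆B
  ... | inj₂ (inj₂ (u , a , v , ≡.refl , rest)) = inj₂ (inj₂ (x ∷ u , a , v , ≡.refl , rest))
  ... | inj₁ (a , a∈ , a∉) with full? B (x ∷ w)
  ...   | inj₂ missing = inj₁ missing
  ...   | inj₁ full with All.lookup full a∈
  -- A letter missing from `w` but present in `x ∷ w` is `x` itself, so the shortest full suffix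
  -- starts here.
  ...     | here ≡.refl = inj₂ (inj₂ ([] , a , w , ≡.refl , a∈ , a∉ , full))
  ...     | there a∈w   = contradiction a∈w a∉

  Smaller : List A → Atom A → Set
  Smaller B (star C) = length C ℕ.< length B
  Smaller B (opt _)  = ⊤

  -- These contain the words over `B` from which shortest full suffixes can be cut off at most `n`
  -- times before a letter is missing. Such a suffix is a letter `a` followed by a word without `a`,
  -- whence `opt a ∷ star (B without a)`.
  subproducts : List A → ℕ → List (List (Atom A))
  subproducts B zero    = map (λ a → star (B without a) ∷ []) B
  subproducts B (suc n) = map (λ a → star (B without a) ∷ []) B ++
    cartesianProductWith (λ J a → J ++ opt a ∷ star (B without a) ∷ []) (subproducts B n) B

  subproducts-Smaller : ∀ B n {J} → J ∈ˡ subproducts B n → All (Smaller B) J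
  subproducts-Smaller B zero J∈ with ∈-map⁻ _ J∈
  ... | a , a∈ , ≡.refl = length-without a∈ ∷ []
  subproducts-Smaller B (suc n) J∈ with ∈-++⁻ (map _ B) J∈
  ... | inj₁ J∈₁ with ∈-map⁻ _ J∈₁
  ...   | a , a∈ , ≡.refl = length-without a∈ ∷ []
  subproducts-Smaller B (suc n) J∈ | inj₂ J∈₂
    with ∈-cartesianProductWith⁻ _ (subproducts B n) B J∈₂
  ... | J′ , a , J′∈ , a∈ , ≡.refl =
    All.++⁺ (subproducts-Smaller B n J′∈) (tt ∷ length-without a∈ ∷ [])

  star[]⊆[]⊛^ᴸ : ∀ n {w : List A} → All (_∈ˡ []) w → w ∈ ((_∈ˡ []) ⊛) ^ᴸ n
  star[]⊆[]⊛^ᴸ zero    [] = ≡.refl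
  star[]⊆[]⊛^ᴸ (suc n) [] = [] , [] , ≡.refl , (id , id) , star[]⊆[]⊛^ᴸ n []

  -- Cutting off the shortest full suffix leaves a prefix to be treated with one factor fewer. After
  -- `n` cuts the remaining prefix is a further factor if it is full, whence the exponent `suc n`.
  star-dichotomy : (B : List A) (n : ℕ) {w : List A} → All (_∈ˡ B) w →
    w ∈ ((_∈ˡ B) ⊛) ^ᴸ suc n ⊎ Any (w ∈ᴵ_) (subproducts B n)
  star-dichotomy B zero {w} ⊆B with full? B w
  ... | inj₁ full =
    inj₁ (w , [] , ≡.sym (++-identityʳ w) , (All.lookup ⊆B , All.lookup full) , ≡.refl)
  ... | inj₂ (a , a∈ , a∉) = inj₂ (lose (∈-map⁺ _ a∈) (missesLetter ⊆B a∉))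
  star-dichotomy B (suc n) {w} ⊆B with shortestFullSuffix B w ⊆B
  ... | inj₁ (a , a∈ , a∉) = inj₂ (lose (∈-++⁺ˡ (∈-map⁺ _ a∈)) (missesLetter ⊆B a∉))
  -- Over the empty alphabet the word is empty, and the empty word lies in every power.
  ... | inj₂ (inj₁ ≡.refl) = inj₁ (star[]⊆[]⊛^ᴸ (2 + n) ⊆B)
  ... | inj₂ (inj₂ (u , a , v , ≡.refl , a∈ , a∉ , full))
    with star-dichotomy B n (All.++⁻ˡ u ⊆B)
  ...   | inj₁ u∈ = inj₁ (^ᴸ-snoc (suc n) u∈ (All.lookup (All.++⁻ʳ u ⊆B) , All.lookup full))
  ...   | inj₂ u∈ with find u∈
  ...     | J , J∈ , u∈J = inj₂ (lose
    (∈-++⁺ʳ (map _ B) (∈-cartesianProductWith⁺ _ J∈ a∈))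
    (∈ᴵ-++ u∈J (use (missesLetter (All.tail (All.++⁻ʳ u ⊆B)) a∉))))

  -- Dense words, children of a product and termination of the splitting

  module _ (exponent : List A → ℕ) where

    atomSubproducts : Atom A → List (List (Atom A))
    atomSubproducts (star B) = subproducts B (exponent B)
    atomSubproducts (opt a)  = [] ∷ []

    children : List (Atom A) → List (List (Atom A))
    children []      = []
    children (X ∷ I) = map (_++ I) (atomSubproducts X) ++ map (X ∷_) (children I)

    DenseAtom : Atom A → Language A
    DenseAtom (star B) = ((_∈ˡ B) ⊛) ^ᴸ suc (exponent B)
    DenseAtom (opt a)  = ｛ a ∷ [] ｝

    Dense : List (Atom A) → Language A
    Dense []      = ｛ [] ｝
    Dense (X ∷ I) = DenseAtom X · Dense I

    atom-dichotomy : ∀ X {w} → w ∈ᴵ X ∷ [] →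
                     w ∈ DenseAtom X ⊎ Any (w ∈ᴵ_) (atomSubproducts X)
    atom-dichotomy (star B) w∈        = star-dichotomy B (exponent B) (∈-star⁻ w∈)
    atom-dichotomy (opt a)  (skip w∈) = inj₂ (here w∈)
    atom-dichotomy (opt a)  (use [])  = inj₁ ≡.refl

    -- The word is factored atom by atom; a factor that fails to be dense moves the whole word to a
    -- child that replaces its atom.
    dichotomy : ∀ I {w} → w ∈ᴵ I → w ∈ Dense I ⊎ Any (w ∈ᴵ_) (children I)
    dichotomy []      []  = inj₁ ≡.refl
    dichotomy (X ∷ I) w∈ with ∈ᴵ-∷⁻ w∈
    ... | u , v , ≡.refl , u∈ , v∈ with atom-dichotomy X u∈ | dichotomy I v∈
    ...   | inj₁ u∈ᴰ | inj₁ v∈ᴰ = inj₁ (u , v , ≡.refl , u∈ᴰ , v∈ᴰ)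
    ...   | inj₂ u∈′ | _        =
      inj₂ (Any.++⁺ˡ (Any.map⁺ (Any.map (λ u∈J → ∈ᴵ-++ u∈J v∈) u∈′)))
    ...   | inj₁ _   | inj₂ v∈′ =
      inj₂ (Any.++⁺ʳ _ (Any.map⁺ (Any.map (∈ᴵ-++ u∈) v∈′)))

    _◁_ : List (Atom A) → List (Atom A) → Set
    J ◁ I = J ∈ˡ children I

    -- Nested accessibility, as for the multiset extension of a well-founded order.
    Accessible : Atom A → Set
    Accessible X = ∀ {I} → Acc _◁_ I → Acc _◁_ (X ∷ I)

    acc-++ : ∀ {J I} → All Accessible J → Acc _◁_ I → Acc _◁_ (J ++ I)
    acc-++ []       acc-I = acc-I
    acc-++ (a ∷ as) acc-I = a (acc-++ as acc-I)

    -- Inner induction on the accessibility of `I`: a child of `X ∷ I` either replaces `X` by atoms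
    -- accessible by hypothesis, or keeps `X` and passes from `I` to a child of `I`.
    accessible : ∀ {X} → (∀ {J} → J ∈ˡ atomSubproducts X → All Accessible J) → Accessible X
    accessible {X} sub {I} acc-I@(acc rs) = acc λ K∈ →
      [ (λ K∈₁ → replaced (∈-map⁻ _ K∈₁)) , (λ K∈₂ → kept (∈-map⁻ _ K∈₂)) ]′
        (∈-++⁻ (map (_++ I) (atomSubproducts X)) K∈)
      where
      replaced : ∀ {K} → (∃ λ J → J ∈ˡ atomSubproducts X × K ≡ J ++ I) → Acc _◁_ K
      replaced (J , J∈ , ≡.refl) = acc-++ (sub J∈) acc-I
      kept : ∀ {K} → (∃ λ J → J ∈ˡ children I × K ≡ X ∷ J) → Acc _◁_ K
      kept (J , J∈ , ≡.refl) = accessible sub (rs J∈)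

    opt-accessible : ∀ a → Accessible (opt a)
    opt-accessible a = accessible λ { (here ≡.refl) → [] }

    -- `n` is a strict bound on the alphabet size that decreases along the recursion. Subproducts
    -- consist of stars over smaller alphabets and of letters, and letters are always accessible.
    star-accessible : ∀ n B → length B ℕ.< n → Accessible (star B)
    star-accessible (suc n) B (s≤s B≤n) = accessible λ J∈ →
      All.map smaller (subproducts-Smaller B (exponent B) J∈)
      where
      smaller : ∀ {X} → Smaller B X → Accessible X
      smaller {star C} C<B = star-accessible n C (ℕ.<-≤-trans C<B B≤n)
      smaller {opt a}  _   = opt-accessible a

    ◁-accessible : ∀ I → Acc _◁_ I
    ◁-accessible []           = acc λ ()
    ◁-accessible (star B ∷ I) = star-accessible _ B ℕ.≤-refl (◁-accessible I)
    ◁-accessible (opt a ∷ I)  = opt-accessible a (◁-accessible I)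

    -- The cover is made of these sets rather than of `Dense I`: they are Boolean combinations of
    -- products, hence in `BΣ₁`, and the dichotomy puts them inside `Dense I`.
    Leaf : List (Atom A) → Language A
    Leaf I w = w ∈ᴵ I × All (λ J → ¬ w ∈ᴵ J) (children I)

    Leaf⊆Dense : ∀ I → Leaf I ⊆ Dense I
    Leaf⊆Dense I (w∈ , w∉) with dichotomy I w∈
    ... | inj₁ w∈ᴰ = w∈ᴰ
    ... | inj₂ w∈′ = contradiction w∈′ (All.All¬⇒¬Any w∉)

    Covered : Language A → Set
    Covered L = ∃ λ Is → ∀ {w} → w ∈ L → Any (λ J → w ∈ Leaf J) Is

    Covered-Any : ∀ Js → (∀ {J} → J ∈ˡ Js → Covered (_∈ᴵ J)) →
                  Covered (λ w → Any (w ∈ᴵ_) Js)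
    Covered-Any []       cov = [] , λ ()
    Covered-Any (J ∷ Js) cov with cov (here ≡.refl) | Covered-Any Js (cov ∘ there)
    ... | Is , cov₁ | Is′ , cov₂ = Is ++ Is′ ,
      λ { (here w∈) → Any.++⁺ˡ (cov₁ w∈) ; (there w∈) → Any.++⁺ʳ Is (cov₂ w∈) }

    -- A word descends to children that still contain it. Each product has finitely many children
    -- and the descent is well-founded, so a finite list suffices.
    leaves : ∀ {I} → Acc _◁_ I → Covered (_∈ᴵ I)
    leaves {I} (acc rs) with Covered-Any (children I) (λ J∈ → leaves (rs J∈))
    ... | Is , cov = I ∷ Is , λ {w} w∈ → descend w∈ (Any.any? (w ∈ᴵ?_) (children I))
      where
      descend : ∀ {w} → w ∈ᴵ I → Dec (Any (w ∈ᴵ_) (children I)) →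
                Any (λ J → w ∈ Leaf J) (I ∷ Is)
      descend w∈ (yes w∈′) = there (cov w∈′)
      descend w∈ (no w∉)   = here (w∈ , All.¬Any⇒All¬ _ w∉)

    module _ (letters : List A) (letters-complete : ∀ a → a ∈ˡ letters) where

      BΣ₁-Leaf : ∀ I → BΣ₁ (Leaf I)
      BΣ₁-Leaf I = BΣ₁-∩ (BΣ₁-product I) (BΣ₁-All (BΣ₁-∁ ∘ BΣ₁-product) (children I))
        where
        BΣ₁-product = BΣ₁-∈ᴵ letters letters-complete

-- Rating maps and the elements forced into every imprint

module _ {A : Set} {R : FiniteIdempotentSemiring c ℓ} (rm : MultiplicativeRatingMap A R) where

  open FiniteIdempotentSemiring R
    using (Carrier; _≈_; _⊗_; _≤_; _^_; _^ω; ^-congˡ; ^-assocʳ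
          ; IsIdempotentPower-unique; idempotentPower; finite
          ; +-congˡ; +-congʳ; +-assoc; +-idem; *-congˡ; *-congʳ; *-identityʳ
          ; distribˡ; distribʳ)
    renaming (refl to ≈-refl; sym to ≈-sym; trans to ≈-trans)
  open MultiplicativeRatingMap rm using (ρ; +-homo; *-homo; 1#-homo; ⟦⟧-cong)

  ≤-reflexive : ∀ {r t} → r ≈ t → r ≤ t
  ≤-reflexive r≈t = ≈-trans (+-congʳ r≈t) (+-idem _)

  ≤-trans : ∀ {r t u} → r ≤ t → t ≤ u → r ≤ u
  ≤-trans r≤t t≤u =
    ≈-trans (+-congˡ (≈-sym t≤u))
      (≈-trans (≈-sym (+-assoc _ _ _)) (≈-trans (+-congʳ r≤t) t≤u))

  ⊗-mono-≤ : ∀ {r r′ t t′} → r ≤ r′ → t ≤ t′ → r ⊗ t ≤ r′ ⊗ t′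
  ⊗-mono-≤ r≤r′ t≤t′ = ≤-trans
    (≈-trans (≈-sym (distribˡ _ _ _)) (*-congˡ t≤t′))
    (≈-trans (≈-sym (distribʳ _ _ _)) (*-congʳ r≤r′))

  ρ-mono : ∀ {K L : Language A} → K ⊆ L → ρ K ≤ ρ L
  ρ-mono K⊆L = ≈-trans (≈-sym (+-homo _ _)) (⟦⟧-cong ([ K⊆L , id ]′ , inj₂))

  ρ-^ᴸ : ∀ (L : Language A) n → ρ (L ^ᴸ n) ≈ ρ L ^ n
  ρ-^ᴸ L zero    = 1#-homo
  ρ-^ᴸ L (suc n) = ≈-trans (*-homo _ _) (*-congˡ (ρ-^ᴸ L n))

  ωExponent : Carrier → ℕ
  ωExponent t = proj₁ (proj₁ (proj₂ (idempotentPower t)))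

  ^ω≈^ : ∀ t → t ^ω ≈ t ^ suc (ωExponent t)
  ^ω≈^ t = proj₂ (proj₁ (proj₂ (idempotentPower t)))

  ^ω-idem : ∀ t k → (t ^ω) ^ suc k ≈ t ^ω
  ^ω-idem t zero    = *-identityʳ _
  ^ω-idem t (suc k) = ≈-trans (*-congˡ (^ω-idem t k)) (proj₂ (proj₂ (idempotentPower t)))

  -- `_^ω` takes a power found by the pigeonhole principle; its compatibility with `≈` comes from
  -- the uniqueness of idempotent powers.
  ^ω-cong : ∀ {t u} → t ≈ u → t ^ω ≈ u ^ω
  ^ω-cong {t} {u} t≈u = IsIdempotentPower-unique
    ((ωExponent t , ≈-trans (^ω≈^ t) (^-congˡ (suc (ωExponent t)) t≈u)) ,
     proj₂ (proj₂ (idempotentPower t)))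
    (proj₂ (idempotentPower u))

  -- Only alphabets given by lists are used here: every B ⊆ A is such an alphabet up to ¬¬,
  -- which suffices in omega∈I because the imprint of a given cover is decidable.
  data Generated : Pred Carrier (c ⊔ ℓ) where
    word  : ∀ {r} w → r ≤ ρ ｛ w ｝ → Generated r
    down  : ∀ {r r′} → Generated r → r′ ≤ r → Generated r′
    _⊗ᴳ_  : ∀ {r t} → Generated r → Generated t → Generated (r ⊗ t)
    omega : ∀ B → Generated (ρ ((_∈ˡ B) ⊛) ^ω)

  Generated-least : {S : Pred Carrier s} → IsBΣ₁Saturated rm S → Generated ⊆ S
  Generated-least sat = go
    where
    open IsBΣ₁Saturated sat
    go : Generated ⊆ _
    go (word w r≤)   = trivial (w , r≤)
    go (down g r′≤r) = downwardClosed (go g) r′≤r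
    go (g ⊗ᴳ h)      = ⊗-closed (go g) (go h)
    go (omega B)     = ω-closed (_∈ˡ B)

  -- `H` is built along the derivation, as Simon's congruence is compatible with concatenation. It
  -- is nonempty so that some member of a given cover meets it.
  Generated-approximation : ∀ {r} → Generated r → ∀ k → ∃ λ H →
    r ≤ ρ H × ∃ H × (∀ u v → u ∈ H → v ∈ H → u ≲[ k ] v)
  Generated-approximation (word w r≤) k =
    ｛ w ｝ , r≤ , (w , ≡.refl) , λ { _ _ ≡.refl ≡.refl len τ → τ }
  Generated-approximation (down g r′≤r) k with Generated-approximation g k
  ... | H , r≤ , rest = H , ≤-trans r′≤r r≤ , rest
  Generated-approximation (g ⊗ᴳ h) k
    with Generated-approximation g k | Generated-approximation h k
  ... | H , r≤ , (u , u∈) , H≲ | K , t≤ , (v , v∈) , K≲ =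
    H · K , ≤-trans (⊗-mono-≤ r≤ t≤) (≤-reflexive (≈-sym (*-homo H K))) ,
    (u ++ v , u , v , ≡.refl , u∈ , v∈) ,
    λ { _ _ (u₁ , v₁ , ≡.refl , u₁∈ , v₁∈) (u₂ , v₂ , ≡.refl , u₂∈ , v₂∈) →
        ≲-++ (H≲ u₁ u₂ u₁∈ u₂∈) (K≲ v₁ v₂ v₁∈ v₂∈) }
  Generated-approximation (omega B) k =
    (B⊛ ^ᴸ n) , ≤-reflexive ω≈ , ^ᴸ-nonempty {L = B⊛} n (B , id , id) , λ u v → ⊛^ᴸ-≲ k≤n
    where
    B⊛ = (_∈ˡ B) ⊛
    m n : ℕ
    m = suc (ωExponent (ρ B⊛))
    -- A multiple of the exponent `m` keeps the image equal to the idempotent power, and the factor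
    -- `suc k` makes `n` at least `k` while avoiding the power zero.
    n = m * suc k
    k≤n : k ℕ.≤ n
    k≤n = ℕ.≤-trans (ℕ.n≤1+n k) (ℕ.m≤n*m (suc k) m)
    ω≈ : ρ B⊛ ^ω ≈ ρ (B⊛ ^ᴸ n)
    ω≈ = ≈-trans (≈-sym (^ω-idem (ρ B⊛) k))
      (≈-trans (^-congˡ (suc k) (^ω≈^ (ρ B⊛)))
        (≈-trans (^-assocʳ (ρ B⊛) m (suc k)) (≈-sym (ρ-^ᴸ B⊛ n))))

  Generated⊆I : ∀ {Ks} → IsUniversalCover BΣ₁ Ks → Generated ⊆ I[_] rm Ks
  Generated⊆I (bs , covers) g with All-BΣ₁⇒SimonClosed bs
  ... | k , sats with Generated-approximation g k
  ...   | H , r≤ , (w , w∈H) , H≲ = imprint sats (covers w)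
    where
    imprint : ∀ {Ks} → All (SimonClosed k) Ks → Any (w ∈_) Ks → Any (λ K → _ ≤ ρ K) Ks
    -- The member `K` contains `w` and is a union of classes, so it contains all of `H`.
    imprint (sat ∷ _) (here w∈K) = here (≤-trans r≤ (ρ-mono λ {v} v∈H →
      sat w v (H≲ w v w∈H v∈H) (H≲ v w v∈H w∈H) w∈K))
    imprint (_ ∷ sats) (there w∈) = there (imprint sats w∈)

  -- The optimal cover over a finite alphabet

  module _ (finA : IsFinite (setoid A)) where

    _≟ᴬ_ : DecidableEquality A
    _≟ᴬ_ = via-injection (Inverse⇒Injection (proj₂ finA)) _≟ᶠ_

    _≈?_ : Decidable _≈_
    _≈?_ = via-injection (Inverse⇒Injection (proj₂ finite)) _≟ᶠ_

    letters : List A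
    letters = map (Inverse.from (proj₂ finA)) (allFin _)

    letters-complete : ∀ a → a ∈ˡ letters
    letters-complete a = ≡.subst (_∈ˡ letters) (Inverse.inverseʳ (proj₂ finA) ≡.refl)
      (∈-map⁺ _ (∈-allFin (Inverse.to (proj₂ finA) a)))

    -- Chosen so that `DenseAtom (star B)`, a power with `suc (exponent B)` factors, has the
    -- idempotent power of `ρ ((_∈ˡ B) ⊛)` as its image.
    exponent : List A → ℕ
    exponent B = ωExponent (ρ ((_∈ˡ B) ⊛))

    Generated-DenseAtom : ∀ X → Generated (ρ (DenseAtom _≟ᴬ_ exponent X))
    Generated-DenseAtom (star B) = down (omega B)
      (≤-reflexive (≈-trans (ρ-^ᴸ _ (suc (exponent B))) (≈-sym (^ω≈^ _))))
    Generated-DenseAtom (opt a)  = word (a ∷ []) (≤-reflexive ≈-refl)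

    Generated-Dense : ∀ I → Generated (ρ (Dense _≟ᴬ_ exponent I))
    Generated-Dense []      = word [] (≤-reflexive ≈-refl)
    Generated-Dense (X ∷ I) =
      down (Generated-DenseAtom X ⊗ᴳ Generated-Dense I) (≤-reflexive (*-homo _ _))

    leafProducts : List (List (Atom A))
    leafProducts = proj₁ (leaves _≟ᴬ_ exponent (◁-accessible _≟ᴬ_ exponent (star letters ∷ [])))

    cover : List (Language A)
    cover = map (Leaf _≟ᴬ_ exponent) leafProducts

    cover-universal : IsUniversalCover BΣ₁ cover
    cover-universal =
      All.map⁺ (All.universal (BΣ₁-Leaf _≟ᴬ_ exponent letters letters-complete) leafProducts) ,
      λ w → Any.map⁺ (proj₂ (leaves _≟ᴬ_ exponent (◁-accessible _≟ᴬ_ exponent _))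
        (∈-star⁺ (All.universal letters-complete w)))

    -- An element below the image of a leaf is below that of its dense product, which is a product
    -- of generators.
    I⊆Generated : I[_] rm cover ⊆ Generated
    I⊆Generated r∈ with Any.satisfied (Any.map⁻ {xs = leafProducts} r∈)
    ... | I , r≤ = down (Generated-Dense I)
      (≤-trans r≤ (ρ-mono (Leaf⊆Dense _≟ᴬ_ exponent I)))

    cover-optimal : IsOptimalUniversalCover rm BΣ₁ cover
    cover-optimal = cover-universal , λ _ universal → Generated⊆I universal ∘ I⊆Generated

    OptimalImprint⊆Generated : OptimalImprint rm BΣ₁ ⊆ Generated
    OptimalImprint⊆Generated (_ , optimal , r∈) =
      I⊆Generated (proj₂ optimal cover cover-universal r∈)

    Generated⊆OptimalImprint : Generated ⊆ OptimalImprint rm BΣ₁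
    Generated⊆OptimalImprint g = cover , cover-optimal , Generated⊆I cover-universal g

    -- An enumeration of `B` is available only under double negation. This suffices because
    -- membership in the imprint of the concrete list `cover` is a finite disjunction of decidable
    -- equalities in `R`.
    omega∈I : ∀ (B : Pred A 0ℓ) → ρ (B ⊛) ^ω ∈ I[_] rm cover
    omega∈I B = decidable-stable (Any.any? (λ K → _ ≈? _) cover) λ ∉I →
      ¬¬-enumeration B letters λ (bs , bs⊆B , B⊆bs) →
        let bs≐B : (_∈ˡ bs) ≐ B
            bs≐B = All.lookup bs⊆B , B⊆bs (letters-complete _)
            B⊛≐ : B ⊛ ≐ (_∈ˡ bs) ⊛
            B⊛≐ = (λ (⊆B , B⊆) → proj₂ bs≐B ∘ ⊆B , B⊆ ∘ proj₁ bs≐B) ,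
                  (λ (⊆bs , bs⊆) → proj₁ bs≐B ∘ ⊆bs , bs⊆ ∘ proj₂ bs≐B)
        in ∉I (Generated⊆I cover-universal
                (down (omega bs) (≤-reflexive (^ω-cong (⟦⟧-cong B⊛≐)))))

    OptimalImprint-saturated : IsBΣ₁Saturated rm (OptimalImprint rm BΣ₁)
    OptimalImprint-saturated = record
      { trivial        = λ (w , r≤) → Generated⊆OptimalImprint (word w r≤)
      ; downwardClosed = λ r∈ r′≤r →
          Generated⊆OptimalImprint (down (OptimalImprint⊆Generated r∈) r′≤r)
      ; ⊗-closed       = λ r∈ t∈ → Generated⊆OptimalImprint
          (OptimalImprint⊆Generated r∈ ⊗ᴳ OptimalImprint⊆Generated t∈)
      ; ω-closed       = λ B → cover , cover-optimal , omega∈I B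
      }

theorem7p3 : ∀ {c ℓ s : Level} (A : Set) → IsFinite (setoid A) →
    (R : FiniteIdempotentSemiring c ℓ) (ρ : MultiplicativeRatingMap A R) →
    IsBΣ₁Saturated ρ (OptimalImprint ρ BΣ₁) ×
    (∀ (S : Pred (FiniteIdempotentSemiring.Carrier R) s) →
    IsBΣ₁Saturated ρ S → OptimalImprint ρ BΣ₁ ⊆ S)
theorem7p3 A finA R ρ =
  OptimalImprint-saturated ρ finA ,
  λ S sat → Generated-least ρ sat ∘ OptimalImprint⊆Generated ρ finA
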